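{- Let $\mathcal{S}$ be a nonempty set and let $X$ and $Y$ be lenses with source $\mathcal{S}$ and views $V_1$ and $V_2$ respectively. Then the scenes $X^\sim$ and $Y^\sim$ are independent if and only if $\mathrm{put}_X\,v_1\circ \mathrm{put}_Y\,v_2=\mathrm{put}_Y\,v_2\circ \mathrm{put}_X\,v_1$ for all $v_1\in V_1$, $v_2\in V_2$.
   Context: A lens $X$ with view $V$ and source $\mathcal{S}$ consists of functions $\mathrm{get}_X:\mathcal{S}\to V$ and $\mathrm{put}_X:V\to\mathcal{S}\to\mathcal{S}$ satisfying, for all $s\in\mathcal{S}$ and $v,v'\in V$: $\mathrm{get}_X(\mathrm{put}_X\,v\,s)=v$, $\mathrm{put}_X\,v\,(\mathrm{put}_X\,v'\,s)=\mathrm{put}_X\,v\,s$, and $\mathrm{put}_X\,(\mathrm{get}_X\,s)\,s=s$. A scene on $\mathcal{S}$ is a function $F:\mathcal{S}\to\mathcal{S}\to\mathcal{S}$ satisfying, for all $x,y,z$: $F\,(F\,x\,y)\,z=F\,x\,z$, $F\,x\,(F\,y\,z)=F\,x\,z$, $F\,x\,x=x$. Scenes $F,G$ on $\mathcal{S}$ are independent if $G\,(F\,s_1\,s_2)\,s_3=F\,(G\,s_1\,s_3)\,s_2$ for all $s_1,s_2,s_3\in\mathcal{S}$. The scene of a lens $X$ is $X^\sim=(\lambda s_1\,s_2.\ \mathrm{put}_X\,(\mathrm{get}_X\,s_2)\,s_1)$. -}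

module Defs where

open import Level using (Level; _⊔_)
open import Relation.Binary.PropositionalEquality
  using (_≡_; cong)

private
  variable
    v s : Level

record Lens (V : Set v) (S : Set s) : Set (v ⊔ s) where
  field
    get     : S → V
    put     : V → S → S
    get-put : ∀ x a → get (put a x) ≡ a
    put-put : ∀ x a b → put a (put b x) ≡ put a x
    put-get : ∀ x → put (get x) x ≡ x

record Scene (S : Set s) : Set s where
  field
    overwrite : S → S → S
    absorbˡ   : ∀ x y z → overwrite (overwrite x y) z ≡ overwrite x z
    absorbʳ   : ∀ x y z → overwrite x (overwrite y z) ≡ overwrite x z
    idem      : ∀ x → overwrite x x ≡ x

Independent : {S : Set s} → Scene S → Scene S → Set s
Independent F G = ∀ s₁ s₂ s₃ → g (f s₁ s₂) s₃ ≡ f (g s₁ s₃) s₂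
  where
  f = Scene.overwrite F
  g = Scene.overwrite G

infix 30 _∼

_∼ : {V : Set v} {S : Set s} → Lens V S → Scene S
X ∼ = record
  { overwrite = λ s₁ s₂ → put (get s₂) s₁
  ; absorbˡ   = λ x y z → put-put x (get z) (get y)
  ; absorbʳ   = λ x y z → cong (λ a → put a x) (get-put y (get z))
  ; idem      = put-get
  }
  where open Lens X

{-# OPTIONS --safe #-}
module Submission where

open import Defs
open import Function using (_∘_; _⇔_; mk⇔)
open import Relation.Binary.PropositionalEquality using (_≡_; _≗_; sym; subst₂)

-- Unfolded, independence at `s₁ s₂ s₃` says that the two puts commute on `s₁` for the values
-- `X.get s₂` and `Y.get s₃`. So it is commutation restricted to values in the images of the two
-- gets, and these images are the whole view types.

theorem11 : ∀ {s a b} {S : Set s} {V₁ : Set a} {V₂ : Set b} →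
    S → (X : Lens V₁ S) (Y : Lens V₂ S) →
    Independent (X ∼) (Y ∼) ⇔
    (∀ v₁ v₂ → Lens.put X v₁ ∘ Lens.put Y v₂ ≗ Lens.put Y v₂ ∘ Lens.put X v₁)
theorem11 _ X Y = mk⇔
  -- By get-put, every view v is get of some source, namely of put v s.
  (λ indep v₁ v₂ s →
    subst₂ (λ a b → X.put a (Y.put b s) ≡ Y.put b (X.put a s))
      (X.get-put s v₁) (Y.get-put s v₂)
      -- `s` is both the state acted on and the seed of the two sources that show `v₁` and `v₂`.
      (sym (indep s (X.put v₁ s) (Y.put v₂ s))))
  (λ comm s₁ s₂ s₃ → sym (comm (X.get s₂) (Y.get s₃) s₁))
  where
  module X = Lens X
  module Y = Lens Y
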